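{- For all integers $n\geq 0$, \[ c\psi_{2,0}(n)=2\,\sigma\mathrm{mex}_2(n) \qquad\text{and}\qquad c\psi_{2,1}(n)=2\,\sigma\mathrm{mex}_2(n)-E_2(n). \]
   Context: Colored Frobenius partitions. A colored integer is a pair $(m,j)$ with $m$ a non-negative integer and $j$ a color; for two colors, $j\in\{0,1\}$. Colored integers are ordered lexicographically: first by the usual order on $m$, then by the color order $0<1$. For $a\in\{0,1\}$, a $(2,a)$-colored Frobenius partition is a two-rowed array \[ \Pi=\begin{pmatrix} a_1&a_2&\cdots&a_r\\ b_1&b_2&\cdots&b_s\end{pmatrix} \] (with $r,s\geq 0$; a row may be empty) such that: each entry is a colored integer with color in $\{0,1\}$; each row is strictly decreasing with respect to the lexicographic order; and $r-s=a-1$. Its weight is $|\Pi|=r+\sum_{i=1}^r a_i+\sum_{j=1}^s b_j$, where the numerical values of the entries are used and colors are ignored. $c\psi_{2,a}(n)$ denotes the number of $(2,a)$-colored Frobenius partitions of weight $n$. Minimal excludants. A partition is a finite weakly decreasing sequence of positive integers (possibly empty); $|\lambda|$ is the sum of its parts. For a partition $\lambda$, $\mathrm{mex}(\lambda):=\min\{m\geq 1: m\text{ is not a part of }\lambda\}$. A bipartition of $n$ is an ordered pair $\pi=(\pi_1,\pi_2)$ of partitions with $|\pi_1|+|\pi_2|=n$, written $\pi\vdash_2 n$. Put $\mathrm{mex}_2(\pi):=\min\{\mathrm{mex}(\pi_1),\mathrm{mex}(\pi_2)\}$ and \[ \sigma\mathrm{mex}_2(n):=\sum_{\pi\vdash_2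 n}\mathrm{mex}_2(\pi), \qquad E_2(n):=\#\{\pi=(\pi_1,\pi_2)\vdash_2 n:\mathrm{mex}(\pi_1)=\mathrm{mex}(\pi_2)\}. \] -}

module Defs where

open import Data.Fin.Base using (Fin; toℕ)
import Data.Fin.Base as Fin
import Data.Fin.Properties as Fin
open import Data.Integer.Base using (ℤ; +_; _-_)
import Data.Integer.Base as ℤ
import Data.Integer.Properties as ℤ
open import Data.Integer.Tactic.RingSolver using (solve-∀)
open import Data.List.Base
  using (List; []; _∷_; length; map; filter; deduplicate; cartesianProduct;
         cartesianProductWith; upTo; allFin)
open import Data.List.Membership.Propositional using (_∈_; _∉_)
import Data.List.Membership.DecPropositional as DecMembership
open import Data.List.Membership.Propositional.Properties
  using (∈-filter⁺; ∈-filter⁻; ∈-deduplicate⁺; ∈-deduplicate⁻;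
         ∈-cartesianProduct⁺; ∈-cartesianProductWith⁺; ∈-upTo⁺; ∈-allFin)
open import Data.List.Properties using (≡-dec)
open import Data.List.Relation.Unary.All as All using (All; []; _∷_)
open import Data.List.Relation.Unary.All.Properties using (map⁻)
open import Data.List.Relation.Unary.Any using (here; there)
open import Data.List.Relation.Unary.Linked using (Linked; linked?)
open import Data.List.Relation.Unary.Unique.Propositional using (Unique)
open import Data.List.Relation.Unary.Unique.DecPropositional.Properties using (deduplicate-!)
open import Data.Nat.Base
  using (ℕ; zero; suc; _+_; _≤_; _<_; _≥_; _⊓_; z≤n; s≤s)
open import Data.Nat.ListAction using (sum)
open import Data.Nat.Properties
  using (_≟_; _≤?_; _<?_; _≥?_; ≤-trans; m≤m+n; m≤n+m; +-mono-≤; 1+n≰n)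
open import Data.Product.Base using (∃; _×_; _,_; proj₁; proj₂)
open import Data.Product.Properties using () renaming (≡-dec to ×-≡-dec)
open import Data.Product.Relation.Binary.Lex.Strict using (×-Lex; ×-decidable)
open import Function.Base using (_∘_; flip)
open import Relation.Binary.Definitions using (DecidableEquality) renaming (Decidable to Decidable₂)
open import Relation.Binary.PropositionalEquality using (_≡_; refl; cong)
open import Relation.Nullary using (yes; no; contradiction)
open import Relation.Nullary.Decidable using (_×-dec_; ¬?)
open import Relation.Unary using (Pred; Decidable)
open import Level using (0ℓ)

private
  variable
    A : Set

-- The list of an Enumeration P is determined by P up to permutation, so counts
-- and sums over it do not depend on the search space it was filtered from.

record Enumeration (P : Pred A 0ℓ) : Set where
  field
    list     : List A
    unique   : Unique list
    sound    : ∀ {x} → x ∈ list → P x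
    complete : ∀ {x} → P x → x ∈ list

open Enumeration public

enumerate : {P : Pred A 0ℓ} → DecidableEquality A → Decidable P →
            (xs : List A) → (∀ {x} → P x → x ∈ xs) → Enumeration P
enumerate _≈?_ P? xs covers = record
  { list     = deduplicate _≈?_ (filter P? xs)
  ; unique   = deduplicate-! _≈?_ (filter P? xs)
  ; sound    = λ x∈ → proj₂ (∈-filter⁻ P? {xs = xs} (∈-deduplicate⁻ _≈?_ (filter P? xs) x∈))
  ; complete = λ px → ∈-deduplicate⁺ _≈?_ (∈-filter⁺ P? (covers px) px)
  }

wordsUpTo : ℕ → List A → List (List A)
wordsUpTo zero    xs = [] ∷ []
wordsUpTo (suc l) xs = [] ∷ cartesianProductWith _∷_ xs (wordsUpTo l xs)

∈-wordsUpTo : ∀ {l} {xs w : List A} → length w ≤ l → All (_∈ xs) w → w ∈ wordsUpTo l xs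
∈-wordsUpTo {l = zero}  {w = []}    _       _         = here refl
∈-wordsUpTo {l = suc l} {w = []}    _       _         = here refl
∈-wordsUpTo {l = suc l} {w = _ ∷ _} (s≤s p) (x∈ ∷ w∈) =
  there (∈-cartesianProductWith⁺ _∷_ x∈ (∈-wordsUpTo p w∈))

all≤sum : ∀ xs → All (_≤ sum xs) xs
all≤sum []       = []
all≤sum (x ∷ xs) = m≤m+n x _ ∷ All.map (λ p → ≤-trans p (m≤n+m _ x)) (all≤sum xs)

ColoredInteger : Set
ColoredInteger = ℕ × Fin 2

_≺_ : ColoredInteger → ColoredInteger → Set
_≺_ = ×-Lex _≡_ _<_ Fin._<_

StrictlyDecreasing : List ColoredInteger → Set
StrictlyDecreasing = Linked (flip _≺_)

-- (top row , bottom row)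
Array : Set
Array = List ColoredInteger × List ColoredInteger

weight : Array → ℕ
weight (as , bs) = length as + sum (map proj₁ as) + sum (map proj₁ bs)

IsColoredFrobenius : Fin 2 → Array → Set
IsColoredFrobenius a (as , bs) =
  StrictlyDecreasing as × StrictlyDecreasing bs ×
  (+ length as) - (+ length bs) ≡ (+ toℕ a) - (+ 1)

IsColoredFrobeniusOf : Fin 2 → ℕ → Array → Set
IsColoredFrobeniusOf a n Π = IsColoredFrobenius a Π × weight Π ≡ n

_≟ᶜ_ : DecidableEquality ColoredInteger
_≟ᶜ_ = ×-≡-dec _≟_ Fin._≟_

strictlyDecreasing? : Decidable StrictlyDecreasing
strictlyDecreasing? = linked? (λ x y → ×-decidable _≟_ _<?_ Fin._<?_ y x)

isColoredFrobeniusOf? : ∀ a n → Decidable (IsColoredFrobeniusOf a n)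
isColoredFrobeniusOf? a n (as , bs) =
  (strictlyDecreasing? as ×-dec strictlyDecreasing? bs ×-dec
   ((+ length as) - (+ length bs) ℤ.≟ (+ toℕ a) - (+ 1)))
  ×-dec (weight (as , bs) ≟ n)

bottomLength≤ : ∀ (a : Fin 2) r s → (+ r) - (+ s) ≡ (+ toℕ a) - (+ 1) → s ≤ suc r
bottomLength≤ a r s eq = ℤ.drop‿+≤+ (begin
  + s                                       ≡⟨ ℤ.+-identityʳ (+ s) ⟨
  + s ℤ.+ + 0                               ≤⟨ ℤ.+-monoʳ-≤ (+ s) (ℤ.+≤+ z≤n) ⟩
  + s ℤ.+ + toℕ a                           ≡⟨ cong (λ x → (+ s) ℤ.+ x) (x≡x-1+1 (+ toℕ a)) ⟩
  + s ℤ.+ ((+ toℕ a - + 1) ℤ.+ + 1)         ≡⟨ cong (λ d → + s ℤ.+ (d ℤ.+ + 1)) eq ⟨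
  + s ℤ.+ ((+ r - + s) ℤ.+ + 1)             ≡⟨ cancel (+ s) (+ r) ⟩
  + suc r                                   ∎)
  where
  open ℤ.≤-Reasoning
  x≡x-1+1 : ∀ (x : ℤ) → x ≡ (x - + 1) ℤ.+ + 1
  x≡x-1+1 = solve-∀
  cancel : ∀ (x y : ℤ) → x ℤ.+ ((y - x) ℤ.+ + 1) ≡ + 1 ℤ.+ y
  cancel = solve-∀

coloredUpTo : ℕ → List ColoredInteger
coloredUpTo n = cartesianProduct (upTo (suc n)) (allFin 2)

rowCovered : ∀ {l n} (as : List ColoredInteger) → length as ≤ l → sum (map proj₁ as) ≤ n →
             as ∈ wordsUpTo l (coloredUpTo n)
rowCovered as len≤ sum≤ = ∈-wordsUpTo len≤
  (All.map (λ p → ∈-cartesianProduct⁺ (∈-upTo⁺ (s≤s (≤-trans p sum≤))) (∈-allFin _))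
           (map⁻ (all≤sum (map proj₁ as))))

coloredFrobeniusPartitions : ∀ a n → Enumeration (IsColoredFrobeniusOf a n)
coloredFrobeniusPartitions a n =
  enumerate (×-≡-dec (≡-dec _≟ᶜ_) (≡-dec _≟ᶜ_)) (isColoredFrobeniusOf? a n)
    (cartesianProduct (wordsUpTo n (coloredUpTo n)) (wordsUpTo (suc n) (coloredUpTo n)))
    covers
  where
  covers : ∀ {Π} → IsColoredFrobeniusOf a n Π →
           Π ∈ cartesianProduct (wordsUpTo n (coloredUpTo n)) (wordsUpTo (suc n) (coloredUpTo n))
  covers {as , bs} ((_ , _ , bal) , refl) = ∈-cartesianProduct⁺
    (rowCovered as r≤ (≤-trans (m≤n+m _ (length as)) (m≤m+n _ _)))
    (rowCovered bs (≤-trans (bottomLength≤ a _ _ bal) (s≤s r≤))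
      (m≤n+m _ (length as + sum (map proj₁ as))))
    where
    r≤ : length as ≤ weight (as , bs)
    r≤ = ≤-trans (m≤m+n _ _) (m≤m+n _ _)

cψ₂ : Fin 2 → ℕ → ℕ
cψ₂ a n = length (list (coloredFrobeniusPartitions a n))

IsPartition : List ℕ → Set
IsPartition λs = Linked _≥_ λs × All (1 ≤_) λs

Bipartition : Set
Bipartition = List ℕ × List ℕ

_⊢₂_ : Bipartition → ℕ → Set
(π₁ , π₂) ⊢₂ n = IsPartition π₁ × IsPartition π₂ × sum π₁ + sum π₂ ≡ n

isPartition? : Decidable IsPartition
isPartition? λs = linked? _≥?_ λs ×-dec All.all? (1 ≤?_) λs

_⊢₂?_ : Decidable₂ _⊢₂_
(π₁ , π₂) ⊢₂? n = isPartition? π₁ ×-dec isPartition? π₂ ×-dec (sum π₁ + sum π₂ ≟ n)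

length≤sum : ∀ {xs} → All (1 ≤_) xs → length xs ≤ sum xs
length≤sum []       = z≤n
length≤sum (p ∷ ps) = +-mono-≤ p (length≤sum ps)

partitionCovered : ∀ {n λs} → IsPartition λs → sum λs ≤ n → λs ∈ wordsUpTo n (upTo (suc n))
partitionCovered {λs = λs} (_ , pos) sum≤ = ∈-wordsUpTo
  (≤-trans (length≤sum pos) sum≤)
  (All.map (λ p → ∈-upTo⁺ (s≤s (≤-trans p sum≤))) (all≤sum λs))

bipartitions : ∀ n → Enumeration (_⊢₂ n)
bipartitions n =
  enumerate (×-≡-dec (≡-dec _≟_) (≡-dec _≟_)) (_⊢₂? n)
    (cartesianProduct (wordsUpTo n (upTo (suc n))) (wordsUpTo n (upTo (suc n))))
    λ { (p₁ , p₂ , refl) → ∈-cartesianProduct⁺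
          (partitionCovered p₁ (m≤m+n _ _)) (partitionCovered p₂ (m≤n+m _ _)) }

IsMin : Pred ℕ 0ℓ → Pred ℕ 0ℓ
IsMin P m = P m × (∀ {k} → P k → m ≤ k)

minimum : {P : Pred ℕ 0ℓ} → Decidable P → ∀ w → P w → ∃ (IsMin P)
minimum P? zero    p = zero , p , λ _ → z≤n
minimum P? (suc w) p with P? zero
... | yes p₀ = zero , p₀ , λ _ → z≤n
... | no ¬p₀ with minimum (P? ∘ suc) w p
...   | m , pm , m-min =
  suc m , pm , λ { {zero} p₀ → contradiction p₀ ¬p₀ ; {suc _} q → s≤s (m-min q) }

PositiveNonPart : List ℕ → Pred ℕ 0ℓ
PositiveNonPart λs m = 1 ≤ m × m ∉ λs

positiveNonPart? : ∀ λs → Decidable (PositiveNonPart λs)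
positiveNonPart? λs m = (1 ≤? m) ×-dec ¬? (m ∈? λs)
  where open DecMembership _≟_ using (_∈?_)

hasMex : ∀ λs → ∃ (IsMin (PositiveNonPart λs))
hasMex λs = minimum (positiveNonPart? λs) (suc (sum λs))
  (s≤s z≤n , λ m∈ → 1+n≰n (All.lookup (all≤sum λs) m∈))

mex : List ℕ → ℕ
mex λs = proj₁ (hasMex λs)

mex₂ : Bipartition → ℕ
mex₂ (π₁ , π₂) = mex π₁ ⊓ mex π₂

σmex₂ : ℕ → ℕ
σmex₂ n = sum (map mex₂ (list (bipartitions n)))

E₂ : ℕ → ℕ
E₂ n = length (filter (λ (π₁ , π₂) → mex π₁ ≟ mex π₂) (list (bipartitions n)))

module Submission where

-- Splitting both rows of an array by colour gives two pairs (A , B) of finite sets of naturals,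
-- that is, two Maya diagrams, whose charges |A| - |B| add up to a - 1. Translating a Maya diagram
-- by one raises its charge c to c + 1 and its weight w = |A| + ΣA + ΣB to w + c + 1, so that
-- 2w - c(c + 1) is invariant; after enough translations B is empty and A is a staircase plus a
-- partition λ. Hence diagrams of charge k and weight w correspond to partitions λ with
-- |λ| + k(k + 1)/2 = w (Jacobi's triple product), and, on adjoining the parts 1, …, j to λ, to
-- partitions of w with mex > j, where j = k or j = -1 - k. So the arrays of weight n correspond to
-- bipartitions π of n together with a charge whose admissible values number 2 mex₂(π) for a = 0,
-- and 2 mex₂(π) - [mex π₁ = mex π₂] for a = 1.

open import Defs
import Algebra.Properties.AbelianGroup
open import Data.Bool.Base using (Bool; true; false; not)
open import Data.Bool.Properties using (not-injective)
open import Data.Empty using (⊥)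
open import Data.Fin.Base using (Fin; zero; suc; toℕ)
open import Data.Fin.Patterns using (0F; 1F)
import Data.Fin.Properties as Fin
open import Data.Integer.Base as ℤ using (ℤ; +_; -[1+_]; _-_)
import Data.Integer.Properties as ℤ
import Data.Integer.Tactic.RingSolver as ℤSolver
open import Data.List.Base using (List; []; _∷_; [_]; length; lookup; map; _++_; filter; upTo)
open import Data.List.Membership.Propositional using (_∈_)
open import Data.List.Membership.Propositional.Properties
  using (∈-lookup; ∈-map⁺; ∈-map⁻; ∈-++⁺ˡ; ∈-++⁺ʳ; ∈-++⁻; ∈-upTo⁺; ∈-upTo⁻)
open import Data.List.Properties
  using (∷-injective; ∷-injectiveˡ; ∷-injectiveʳ; ++-identityʳ; length-map; length-++; length-upTo;
         map-cong; filter-++; filter-all; filter-accept; filter-reject)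
open import Data.List.Relation.Unary.All as All using (All; []; _∷_)
import Data.List.Relation.Unary.All.Properties as All
open import Data.List.Relation.Unary.AllPairs using (AllPairs; []; _∷_)
import Data.List.Relation.Unary.AllPairs.Properties as AllPairs
open import Data.List.Relation.Unary.Any as Any using (here; there)
open import Data.List.Relation.Unary.Any.Properties using (lookup-index)
open import Data.List.Relation.Unary.Linked.Properties using (Linked⇒AllPairs; AllPairs⇒Linked)
open import Data.List.Relation.Unary.Unique.Propositional using (Unique)
import Data.List.Relation.Unary.Unique.Propositional.Properties as Unique
open import Data.Nat.Base
  using (ℕ; zero; suc; pred; _+_; _*_; _∸_; _⊓_; _≤_; _<_; _≥_; _>_; z≤n; s≤s; s≤s⁻¹; z<s; s<s; s<s⁻¹)
open import Data.Nat.ListAction using (sum)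
open import Data.Nat.ListAction.Properties using (sum-++)
open import Data.Nat.Properties
import Data.Nat.Tactic.RingSolver as ℕSolver
open import Data.List.Membership.DecPropositional _≟_ using (_∈?_)
open import Data.Product.Base using (∃-syntax; ∃₂; _×_; _,_; proj₁; proj₂)
open import Data.Product.Relation.Binary.Lex.Strict using (×-transitive; ×-asymmetric)
open import Data.Sum.Base using (_⊎_; inj₁; inj₂; [_,_]′)
open import Function.Base using (flip; _∘_; id)
open import Level using (0ℓ)
open import Relation.Binary.Definitions using (Transitive; Asymmetric)
open import Relation.Binary.PropositionalEquality
  using (_≡_; _≢_; refl; sym; trans; cong; cong₂; subst; subst₂; resp₂; isEquivalence; module ≡-Reasoning)
open import Relation.Nullary using (contradiction; yes; no)
open import Relation.Unary using (Pred; _⟨×⟩_)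

private
  module ℤ-Group = Algebra.Properties.AbelianGroup ℤ.+-0-abelianGroup

  variable
    A B C I : Set
    b c : Bool
    k l m n v : ℕ
    xs ys xs′ ys′ : List ℕ
    r r′ : List ColoredInteger

-- Bijections between predicates

-- A bijection is encoded as a relation, so that inverting it only swaps fields and a step like a
-- translation run needs no function in either direction. Elements are compared without their
-- membership proofs, which may be far from unique.
record _≃_ {A B : Set} (P : Pred A 0ℓ) (Q : Pred B 0ℓ) : Set₁ where
  field
    _∼_        : A → B → Set
    total      : ∀ {x} → P x → ∃[ y ] Q y × x ∼ y
    surjective : ∀ {y} → Q y → ∃[ x ] P x × x ∼ y
    functional : ∀ {x y y′} → P x → Q y → Q y′ → x ∼ y → x ∼ y′ → y ≡ y′
    injective  : ∀ {x x′ y} → P x → P x′ → Q y → x ∼ y → x′ ∼ y → x ≡ x′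

open _≃_ using (total; surjective; functional; injective)

≃-sym : {P : Pred A 0ℓ} {Q : Pred B 0ℓ} → P ≃ Q → Q ≃ P
≃-sym f = record
  { _∼_        = λ y x → _≃_._∼_ f x y
  ; total      = surjective f
  ; surjective = total f
  ; functional = λ qy px px′ → injective f px px′ qy
  ; injective  = λ qy qy′ px → functional f px qy qy′
  }

≃-trans : {P : Pred A 0ℓ} {Q : Pred B 0ℓ} {R : Pred C 0ℓ} → P ≃ Q → Q ≃ R → P ≃ R
≃-trans {Q = Q} f g = record
  -- The intermediate element must satisfy `Q`, because both factors are functional and injective
  -- only on their predicates.
  { _∼_        = λ x z → ∃[ y ] Q y × x ∼ᶠ y × y ∼ᵍ z
  ; total      = λ px → let y , qy , x∼y = total f px; z , rz , y∼z = total g qy in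
                 z , rz , y , qy , x∼y , y∼z
  ; surjective = λ rz → let y , qy , y∼z = surjective g rz; x , px , x∼y = surjective f qy in
                 x , px , y , qy , x∼y , y∼z
  ; functional = λ { px rz rz′ (y , qy , x∼y , y∼z) (y′ , qy′ , x∼y′ , y′∼z′) →
                   functional g qy′ rz rz′
                     (subst (_∼ᵍ _) (functional f px qy qy′ x∼y x∼y′) y∼z) y′∼z′ }
  ; injective  = λ { px px′ rz (y , qy , x∼y , y∼z) (y′ , qy′ , x′∼y′ , y′∼z) →
                   injective f px px′ qy′
                     (subst (_ ∼ᶠ_) (injective g qy qy′ rz y∼z y′∼z) x∼y) x′∼y′ }
  }
  where open _≃_ f renaming (_∼_ to _∼ᶠ_) using ()
        open _≃_ g renaming (_∼_ to _∼ᵍ_) using ()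

⇔⇒≃ : {P Q : Pred A 0ℓ} → (∀ {x} → P x → Q x) → (∀ {x} → Q x → P x) → P ≃ Q
⇔⇒≃ to from = record
  { _∼_        = _≡_
  ; total      = λ px → _ , to px , refl
  ; surjective = λ qx → _ , from qx , refl
  ; functional = λ { _ _ _ refl refl → refl }
  ; injective  = λ { _ _ _ refl refl → refl }
  }

×-≃ : {P : Pred A 0ℓ} {Q : Pred B 0ℓ} {C D : Set} {P′ : Pred C 0ℓ} {Q′ : Pred D 0ℓ} →
      P ≃ Q → P′ ≃ Q′ → (P ⟨×⟩ P′) ≃ (Q ⟨×⟩ Q′)
×-≃ f g = record
  { _∼_        = λ (x , x′) (y , y′) → _≃_._∼_ f x y × _≃_._∼_ g x′ y′
  ; total      = λ (px , px′) → let y , qy , r = total f px; y′ , qy′ , r′ = total g px′ in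
                 (y , y′) , (qy , qy′) , (r , r′)
  ; surjective = λ (qy , qy′) → let x , px , r = surjective f qy; x′ , px′ , r′ = surjective g qy′ in
                 (x , x′) , (px , px′) , (r , r′)
  ; functional = λ (p , p′) (q , q′) (s , s′) (r , r′) (t , t′) →
                 cong₂ _,_ (functional f p q s r t) (functional g p′ q′ s′ r′ t′)
  ; injective  = λ (p , p′) (q , q′) (s , s′) (r , r′) (t , t′) →
                 cong₂ _,_ (injective f p q s r t) (injective g p′ q′ s′ r′ t′)
  }

Σ-≃ : {J : Pred I 0ℓ} {P : I → Pred A 0ℓ} {Q : I → Pred B 0ℓ} → (∀ i → P i ≃ Q i) →
      _≃_ {I × A} {I × B} (λ (i , x) → J i × P i x) (λ (i , y) → J i × Q i y)
Σ-≃ f = record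
  { _∼_        = λ (i , x) (j , y) → i ≡ j × _≃_._∼_ (f i) x y
  ; total      = λ { {i , x} (ji , px) → let y , qy , r = total (f i) px in
                     (i , y) , (ji , qy) , refl , r }
  ; surjective = λ { {i , y} (ji , qy) → let x , px , r = surjective (f i) qy in
                     (i , x) , (ji , px) , refl , r }
  ; functional = λ { {i , x} (_ , p) (_ , q) (_ , q′) (refl , r) (refl , r′) →
                     cong (i ,_) (functional (f i) p q q′ r r′) }
  ; injective  = λ { {_} {_} {i , y} (_ , p) (_ , p′) (_ , q) (refl , r) (refl , r′) →
                     cong (i ,_) (injective (f i) p p′ q r r′) }
  }

-- Cardinalities of enumerated predicates

lookup-injective : {xs : List A} → Unique xs → ∀ {i j} → lookup xs i ≡ lookup xs j → i ≡ j
lookup-injective (_ ∷ _)   {zero}  {zero}  _  = refl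
lookup-injective (x∉ ∷ _)  {zero}  {suc j} eq = contradiction eq (All.lookup x∉ (∈-lookup j))
lookup-injective (x∉ ∷ _)  {suc i} {zero}  eq = contradiction (sym eq) (All.lookup x∉ (∈-lookup i))
lookup-injective (_ ∷ xs!) {suc i} {suc j} eq = cong suc (lookup-injective xs! eq)

-- Pigeonhole: each position in `list e` is sent to a position of its image in `list e′`. Equal
-- target positions mean equal images, hence equal sources, and these sit at one position because
-- the list has no repetitions.
≃⇒length≤ : {P : Pred A 0ℓ} {Q : Pred B 0ℓ} → P ≃ Q →
            (e : Enumeration P) (e′ : Enumeration Q) → length (list e) ≤ length (list e′)
≃⇒length≤ {P = P} {Q} f e e′ = Fin.injective⇒≤ {f = Any.index ∘ position} λ {i} {j} eq →
  lookup-injective (unique e) (injective f (source i) (source j) (target j)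
    (subst (_ ∼_) (trans (lookup-index (position i))
      (trans (cong (lookup (list e′)) eq) (sym (lookup-index (position j))))) (related i)) (related j))
  where
  open _≃_ f using (_∼_)
  source : ∀ i → P (lookup (list e) i)
  source i = sound e (∈-lookup i)
  image : Fin (length (list e)) → _
  image i = proj₁ (total f (source i))
  target : ∀ i → Q (image i)
  target i = proj₁ (proj₂ (total f (source i)))
  related : ∀ i → lookup (list e) i ∼ image i
  related i = proj₂ (proj₂ (total f (source i)))
  position : ∀ i → image i ∈ list e′
  position i = complete e′ (target i)

≃⇒length≡ : {P : Pred A 0ℓ} {Q : Pred B 0ℓ} → P ≃ Q →
            (e : Enumeration P) (e′ : Enumeration Q) → length (list e) ≡ length (list e′)
≃⇒length≡ f e e′ = ≤-antisym (≃⇒length≤ f e e′) (≃⇒length≤ (≃-sym f) e′ e)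

module _ (f : A → List C) where

  -- The disjoint union of the fibres `f x`. It will enumerate bipartitions together with an
  -- admissible charge, which turns a sum of fibre sizes into a single cardinality.
  graph : List A → List (A × C)
  graph []       = []
  graph (x ∷ xs) = map (x ,_) (f x) ++ graph xs

  length-graph : ∀ xs → length (graph xs) ≡ sum (map (length ∘ f) xs)
  length-graph []       = refl
  length-graph (x ∷ xs) = trans (length-++ (map (x ,_) (f x)))
    (cong₂ _+_ (length-map (x ,_) (f x)) (length-graph xs))

  ∈-graph⁺ : ∀ {x c xs} → x ∈ xs → c ∈ f x → (x , c) ∈ graph xs
  ∈-graph⁺ (here refl) c∈ = ∈-++⁺ˡ (∈-map⁺ _ c∈)
  ∈-graph⁺ {xs = y ∷ _} (there x∈) c∈ = ∈-++⁺ʳ (map (y ,_) (f y)) (∈-graph⁺ x∈ c∈)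

  ∈-graph⁻ : ∀ {x c} xs → (x , c) ∈ graph xs → x ∈ xs × c ∈ f x
  ∈-graph⁻ (y ∷ xs) xc∈ with ∈-++⁻ (map (y ,_) (f y)) xc∈
  ... | inj₁ xc∈′ with _ , c∈ , refl ← ∈-map⁻ (y ,_) xc∈′ = here refl , c∈
  ... | inj₂ xc∈′ with x∈ , c∈ ← ∈-graph⁻ xs xc∈′ = there x∈ , c∈

  graph-unique : (∀ x → Unique (f x)) → ∀ {xs} → Unique xs → Unique (graph xs)
  graph-unique f! [] = []
  graph-unique f! {x ∷ xs} (x∉ ∷ xs!) = Unique.++⁺
    (Unique.map⁺ (λ { refl → refl }) (f! x)) (graph-unique f! xs!)
    λ (v∈ , v∈′) → let _ , _ , eq = ∈-map⁻ (x ,_) v∈ in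
      All.lookup x∉ (proj₁ (∈-graph⁻ xs v∈′)) (cong proj₁ (sym eq))

  enumerateGraph : {P : Pred A 0ℓ} → (∀ x → Unique (f x)) → Enumeration P →
                   Enumeration (λ (x , c) → P x × c ∈ f x)
  enumerateGraph f! e = record
    { list     = graph (list e)
    ; unique   = graph-unique f! (unique e)
    ; sound    = λ xc∈ → let x∈ , c∈ = ∈-graph⁻ (list e) xc∈ in sound e x∈ , c∈
    ; complete = λ (px , c∈) → ∈-graph⁺ (complete e px) c∈
    }

-- Maya diagrams

Decreasing : Pred (List ℕ) 0ℓ
Decreasing = AllPairs _>_

WeaklyDecreasing : Pred (List ℕ) 0ℓ
WeaklyDecreasing = AllPairs _≥_

-- A finite set shifted up by one, with the Boolean deciding whether 0 joins it. Every decreasing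
-- list arises exactly once in this way.
lift : Bool → List ℕ → List ℕ
lift b     (x ∷ xs) = suc x ∷ lift b xs
lift false []       = []
lift true  []       = [ 0 ]

lift-All : ∀ {p} {P : Pred ℕ p} → P 0 → All (P ∘ suc) xs → All P (lift b xs)
lift-All {b = false} p0 []       = []
lift-All {b = true}  p0 []       = p0 ∷ []
lift-All             p0 (p ∷ ps) = p ∷ lift-All p0 ps

lift-All⁻ : ∀ {p} {P : Pred ℕ p} b xs → All P (lift b xs) → All (P ∘ suc) xs
lift-All⁻ b []       ps       = []
lift-All⁻ b (x ∷ xs) (p ∷ ps) = p ∷ lift-All⁻ b xs ps

lift-decreasing : Decreasing xs → Decreasing (lift b xs)
lift-decreasing {b = false} []         = []
lift-decreasing {b = true}  []         = [] ∷ []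
lift-decreasing             (x> ∷ xs↘) = lift-All z<s (All.map s<s x>) ∷ lift-decreasing xs↘

lift-injective : ∀ xs ys → lift b xs ≡ lift c ys → b ≡ c × xs ≡ ys
lift-injective {false} {false} []       []       eq = refl , refl
lift-injective {true}  {true}  []       []       eq = refl , refl
lift-injective {b = false} [] (y ∷ ys) ()
lift-injective {b = true}  [] (y ∷ ys) ()
lift-injective {c = false} (x ∷ xs) [] ()
lift-injective {c = true}  (x ∷ xs) [] ()
lift-injective (x ∷ xs) (y ∷ ys) eq with refl , eq′ ← ∷-injective eq
  with refl , refl ← lift-injective xs ys eq′ = refl , refl

lift-surjective : Decreasing xs → ∃₂ λ b ys → Decreasing ys × lift b ys ≡ xs
lift-surjective [] = false , [] , [] , refl
lift-surjective {xs = zero ∷ []}    _ = true , [] , [] , refl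
lift-surjective {xs = zero ∷ _ ∷ _} ((() ∷ _) ∷ _)
lift-surjective {xs = suc x ∷ xs} (x> ∷ xs↘) with b , ys , ys↘ , refl ← lift-surjective xs↘ =
  b , x ∷ ys , All.map s<s⁻¹ (lift-All⁻ b ys x>) ∷ ys↘ , refl

sum-lift : ∀ b xs → sum (lift b xs) ≡ sum xs + length xs
sum-lift false []       = refl
sum-lift true  []       = refl
sum-lift b     (x ∷ xs) = trans (cong (λ s → suc x + s) (sum-lift b xs)) (lemma x (sum xs) (length xs))
  where
  lemma : ∀ x s l → suc x + (s + l) ≡ (x + s) + suc l
  lemma = ℕSolver.solve-∀

length-lift-false : ∀ xs → length (lift false xs) ≡ length xs
length-lift-false []       = refl
length-lift-false (x ∷ xs) = cong suc (length-lift-false xs)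

length-lift-true : ∀ xs → length (lift true xs) ≡ suc (length xs)
length-lift-true []       = refl
length-lift-true (x ∷ xs) = cong suc (length-lift-true xs)

-- The pair (A , B) stands for the Maya diagram occupied at A ∪ {-1, -2, …} ∖ (-1 - B).
Maya : Set
Maya = List ℕ × List ℕ

charge : Maya → ℤ
charge (as , bs) = + length as - + length bs

energy : Maya → ℕ
energy (as , bs) = length as + sum as + sum bs

IsMaya : Pred Maya 0ℓ
IsMaya (as , bs) = Decreasing as × Decreasing bs

-- Position -1 is occupied iff 0 ∉ B; translation moves it to position 0, that is, into A.
data _⟶_ : Maya → Maya → Set where
  translate : ∀ b as bs → (as , lift b bs) ⟶ (lift (not b) as , bs)

private
  variable
    x y z : Maya

⟶-deterministic : x ⟶ y → x ⟶ z → y ≡ z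
-- The indices of `translate` contain `lift`, which is not a constructor, so the sources are first
-- separated and linked by an equation that `lift-injective` can decompose.
⟶-deterministic p q = go p q refl
  where
  go : ∀ {x x′ y z} → x ⟶ y → x′ ⟶ z → x ≡ x′ → y ≡ z
  go (translate b as bs) (translate c as′ bs′) eq with refl ← cong proj₁ eq
    with refl , refl ← lift-injective bs bs′ (cong proj₂ eq) = refl

⟶-injective : x ⟶ z → y ⟶ z → x ≡ y
⟶-injective p q = go p q refl
  where
  go : ∀ {x y z z′} → x ⟶ z → y ⟶ z′ → z ≡ z′ → x ≡ y
  go (translate b as bs) (translate c as′ bs′) eq with refl ← cong proj₂ eq
    with b≡c , refl ← lift-injective as as′ (cong proj₁ eq)
    with refl ← not-injective b≡c = refl

-- Backwards, position 0 moves to position -1: if 0 lies in the first row, then -1 becomes occupied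
-- and 0 stays out of the second row; otherwise 0 enters it.
⟶-surjective : IsMaya y → ∃[ x ] IsMaya x × x ⟶ y
⟶-surjective (as↘ , bs↘) with lift-surjective as↘
... | true  , as , as↘′ , refl = _ , (as↘′ , lift-decreasing bs↘) , translate false as _
... | false , as , as↘′ , refl = _ , (as↘′ , lift-decreasing bs↘) , translate true as _

⟶-charge : x ⟶ y → charge y ≡ charge x ℤ.+ + 1
⟶-charge (translate true as bs) rewrite length-lift-true bs | length-lift-false as =
  lemma (+ length as) (+ length bs)
  where
  lemma : ∀ i j → i - j ≡ i - (+ 1 ℤ.+ j) ℤ.+ + 1
  lemma = ℤSolver.solve-∀
⟶-charge (translate false as bs) rewrite length-lift-false bs | length-lift-true as =
  lemma (+ length as) (+ length bs)
  where
  lemma : ∀ i j → (+ 1 ℤ.+ i) - j ≡ i - j ℤ.+ + 1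
  lemma = ℤSolver.solve-∀

-- The shift adds the old length of the first row to its sum and removes the new length of the
-- second row from the other sum. With the change in the length of the first row, the total gain is
-- the new charge.
⟶-energy : x ⟶ y → + energy y ≡ + energy x ℤ.+ charge y
⟶-energy (translate b as bs)
  rewrite sum-lift b bs | sum-lift (not b) as =
  lemma (+ length as) (+ length bs) (+ sum as) (+ sum bs) (+ length (lift (not b) as))
  where
  lemma : ∀ l m s t l′ → l′ ℤ.+ (s ℤ.+ l) ℤ.+ t ≡ l ℤ.+ s ℤ.+ (t ℤ.+ m) ℤ.+ (l′ - m)
  lemma = ℤSolver.solve-∀

invariant : Maya → ℤ
invariant x = + 2 ℤ.* + energy x - charge x ℤ.* (charge x ℤ.+ + 1)

⟶-invariant : x ⟶ y → invariant y ≡ invariant x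
⟶-invariant {x} {y} p = trans
  (cong₂ (λ e c → + 2 ℤ.* e - c ℤ.* (c ℤ.+ + 1))
    (trans (⟶-energy p) (cong (λ c → + energy x ℤ.+ c) (⟶-charge p))) (⟶-charge p))
  (lemma (+ energy x) (charge x))
  where
  lemma : ∀ e c → + 2 ℤ.* (e ℤ.+ (c ℤ.+ + 1)) - (c ℤ.+ + 1) ℤ.* (c ℤ.+ + 1 ℤ.+ + 1)
                  ≡ + 2 ℤ.* e - c ℤ.* (c ℤ.+ + 1)
  lemma = ℤSolver.solve-∀

-- Iterated translation

data _⟶[_]_ : Maya → ℕ → Maya → Set where
  done : x ⟶[ 0 ] x
  step : x ⟶ y → y ⟶[ k ] z → x ⟶[ suc k ] z

_▻▻_ : x ⟶[ k ] y → y ⟶[ l ] z → x ⟶[ k + l ] z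
done     ▻▻ q = q
step s p ▻▻ q = step s (p ▻▻ q)

⟶[]-deterministic : x ⟶[ k ] y → x ⟶[ k ] z → y ≡ z
⟶[]-deterministic done       done       = refl
⟶[]-deterministic (step s p) (step t q) with refl ← ⟶-deterministic s t = ⟶[]-deterministic p q

⟶[]-injective : x ⟶[ k ] z → y ⟶[ k ] z → x ≡ y
⟶[]-injective done       done       = refl
⟶[]-injective (step s p) (step t q) with refl ← ⟶[]-injective p q = ⟶-injective s t

⟶[]-surjective : ∀ k → IsMaya y → ∃[ x ] IsMaya x × x ⟶[ k ] y
⟶[]-surjective zero    my = _ , my , done
⟶[]-surjective (suc k) my with _ , mz , p ← ⟶[]-surjective k my
  with _ , mx , s ← ⟶-surjective mz = _ , mx , step s p

⟶[]-charge : x ⟶[ k ] y → charge y ≡ charge x ℤ.+ + k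
⟶[]-charge {x} done = sym (ℤ.+-identityʳ (charge x))
⟶[]-charge {x} {suc k} (step s p) = trans (⟶[]-charge p)
  (trans (cong (ℤ._+ + k) (⟶-charge s)) (ℤ.+-assoc (charge x) (+ 1) (+ k)))

⟶[]-invariant : x ⟶[ k ] y → invariant y ≡ invariant x
⟶[]-invariant done       = refl
⟶[]-invariant (step s p) = trans (⟶[]-invariant p) (⟶-invariant s)

-- Each translation deletes 0 from the second row and lowers its other entries by one, so a bound on
-- the entries also bounds the number of translations needed to empty it.
drain : ∀ k {as bs} → IsMaya (as , bs) → All (_< k) bs →
        ∃[ as′ ] Decreasing as′ × (as , bs) ⟶[ k ] (as′ , [])
drain zero    (as↘ , _) []       = _ , as↘ , done
drain zero    _ (() ∷ _)
drain (suc k) {as} (as↘ , bs↘) bs<k with b , bs , bs↘′ , refl ← lift-surjective bs↘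
  with _ , as′↘ , p ← drain k (lift-decreasing as↘ , bs↘′) (All.map s<s⁻¹ (lift-All⁻ b bs bs<k)) =
  _ , as′↘ , step (translate b as bs) p

-- Staircases added to partitions, and trailing zeros

stair : List ℕ → List ℕ
stair []       = []
stair (x ∷ xs) = x + length xs ∷ stair xs

length-stair : ∀ xs → length (stair xs) ≡ length xs
length-stair []       = refl
length-stair (x ∷ xs) = cong suc (length-stair xs)

stair-All< : All (_≤ n) xs → All (_< n + length xs) (stair xs)
stair-All< [] = []
stair-All< {n} {_ ∷ xs} (x≤n ∷ xs≤n) =
  <-≤-trans (s≤s (+-monoˡ-≤ (length xs) x≤n)) (≤-reflexive (sym (+-suc n (length xs)))) ∷
  All.map (λ p → <-≤-trans p (+-monoʳ-≤ n (n≤1+n (length xs)))) (stair-All< xs≤n)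

-- The amounts added to successive entries are l - 1, ..., 1, 0 for a list of length l, which makes
-- every weak descent strict.
stair-decreasing : WeaklyDecreasing xs → Decreasing (stair xs)
stair-decreasing []         = []
stair-decreasing (x≥ ∷ xs↘) = stair-All< x≥ ∷ stair-decreasing xs↘

stair-injective : ∀ xs ys → stair xs ≡ stair ys → xs ≡ ys
stair-injective []       []       eq = refl
stair-injective (x ∷ xs) (y ∷ ys) eq with eq₁ , eq₂ ← ∷-injective eq
  with refl ← stair-injective xs ys eq₂ = cong (_∷ xs) (+-cancelʳ-≡ (length xs) x y eq₁)

-- Only `x` naturals lie below `x`. This makes the truncated subtraction in `stair-surjective`
-- exact.
length≤head : ∀ {x} → Decreasing (x ∷ xs) → length xs ≤ x
length≤head {[]}     _                     = z≤n
length≤head {_ ∷ xs} ((y<x ∷ _) ∷ xs↘) = ≤-trans (s≤s (length≤head xs↘)) y<x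

stair-All≤⁻ : ∀ xs {n} → All (_< n + length xs) (stair xs) → WeaklyDecreasing xs → All (_≤ n) xs
stair-All≤⁻ []           _          _        = []
stair-All≤⁻ (x ∷ xs) {n} (x< ∷ _) (x≥ ∷ _) = x≤n ∷ All.map (λ p → ≤-trans p x≤n) x≥
  where
  x≤n : x ≤ n
  x≤n = +-cancelʳ-≤ (length xs) x n
    (s≤s⁻¹ (≤-trans x< (≤-reflexive (+-suc n (length xs)))))

stair-surjective : Decreasing xs → ∃[ ys ] WeaklyDecreasing ys × stair ys ≡ xs
stair-surjective [] = [] , [] , refl
stair-surjective {x ∷ _} xs↘@(x> ∷ xs↘′) with ys , ys↘ , refl ← stair-surjective xs↘′ =
  x ∸ length ys ∷ ys ,
  stair-All≤⁻ ys (subst (λ m → All (_< m) (stair ys)) (sym eq) x>) ys↘ ∷ ys↘ ,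
  cong (_∷ stair ys) eq
  where
  eq : x ∸ length ys + length ys ≡ x
  eq = m∸n+n≡m (subst (_≤ x) (length-stair ys) (length≤head xs↘))

-- For a diagram with empty second row, translation amounts to giving the underlying partition one
-- more zero part.
stair-lift : ∀ xs → stair (xs ++ [ 0 ]) ≡ lift true (stair xs)
stair-lift []       = refl
stair-lift (x ∷ xs) = cong₂ _∷_
  (trans (cong (λ l → x + l) (trans (length-++ xs) (+-comm (length xs) 1))) (+-suc x (length xs)))
  (stair-lift xs)

pad : List ℕ → ℕ → List ℕ
pad xs zero    = xs
pad xs (suc n) = pad (xs ++ [ 0 ]) n

pad-pad : ∀ xs m n → pad (pad xs m) n ≡ pad xs (m + n)
pad-pad xs zero    n = refl
pad-pad xs (suc m) n = pad-pad (xs ++ [ 0 ]) m n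

pad-∷ : ∀ x xs n → pad (x ∷ xs) n ≡ x ∷ pad xs n
pad-∷ x xs zero    = refl
pad-∷ x xs (suc n) = pad-∷ x (xs ++ [ 0 ]) n

length-pad : ∀ xs n → length (pad xs n) ≡ length xs + n
length-pad xs zero    = sym (+-identityʳ (length xs))
length-pad xs (suc n) = trans (length-pad (xs ++ [ 0 ]) n)
  (trans (cong (_+ n) (length-++ xs)) (+-assoc (length xs) 1 n))

sum-pad : ∀ xs n → sum (pad xs n) ≡ sum xs
sum-pad xs zero    = refl
sum-pad xs (suc n) = trans (sum-pad (xs ++ [ 0 ]) n) (trans (sum-++ xs [ 0 ]) (+-identityʳ (sum xs)))

pad-weaklyDecreasing : ∀ n → WeaklyDecreasing xs → WeaklyDecreasing (pad xs n)
pad-weaklyDecreasing zero    xs↘ = xs↘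
pad-weaklyDecreasing (suc n) xs↘ =
  pad-weaklyDecreasing n (AllPairs.++⁺ xs↘ ([] ∷ []) (All.universal (λ _ → z≤n ∷ []) _))

Positive : Pred (List ℕ) 0ℓ
Positive = All (1 ≤_)

-- The two numbers of zeros may differ: discarding all zeros recovers the positive parts on either
-- side.
pad-injective : ∀ {m n} → Positive xs → Positive ys → pad xs m ≡ pad ys n → xs ≡ ys
pad-injective {xs} {ys} {m} {n} xs+ ys+ eq = begin
  xs                            ≡⟨ filter-pad m xs+ ⟨
  filter (1 ≤?_) (pad xs m)     ≡⟨ cong (filter (1 ≤?_)) eq ⟩
  filter (1 ≤?_) (pad ys n)     ≡⟨ filter-pad n ys+ ⟩
  ys                            ∎
  where
  open ≡-Reasoning
  filter-pad′ : ∀ xs n → filter (1 ≤?_) (pad xs n) ≡ filter (1 ≤?_) xs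
  filter-pad′ xs zero    = refl
  filter-pad′ xs (suc n) = trans (filter-pad′ (xs ++ [ 0 ]) n)
    (trans (filter-++ (1 ≤?_) xs [ 0 ]) (++-identityʳ _))
  filter-pad : ∀ {zs} n → Positive zs → filter (1 ≤?_) (pad zs n) ≡ zs
  filter-pad {zs} n zs+ = trans (filter-pad′ zs n) (filter-all (1 ≤?_) zs+)

unpad : WeaklyDecreasing xs → ∃₂ λ ys n → WeaklyDecreasing ys × Positive ys × pad ys n ≡ xs
unpad [] = [] , 0 , [] , [] , refl
unpad {zero ∷ xs} (x≥ ∷ xs↘) with unpad xs↘
-- The remaining entries are all zeros, so the leading zero joins the padding; a positive part after
-- it would break the weak descent.
... | []     , n , _            , _       , refl = [] , suc n , [] , [] , pad-∷ 0 [] n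
... | y ∷ ys , n , _ , (y+ ∷ _) , refl rewrite pad-∷ y ys n with y≤0 ∷ _ ← x≥ =
  contradiction (≤-trans y+ y≤0) λ ()
unpad {suc x ∷ xs} (x≥ ∷ xs↘) with ys , n , ys↘ , ys+ , refl ← unpad xs↘ =
  suc x ∷ ys , n , pad-All⁻ n x≥ ∷ ys↘ , s≤s z≤n ∷ ys+ , pad-∷ (suc x) ys n
  where
  pad-All⁻ : ∀ {p} {P : Pred ℕ p} {xs} n → All P (pad xs n) → All P xs
  pad-All⁻ zero    ps = ps
  pad-All⁻ {xs = xs} (suc n) ps = All.++⁻ˡ xs (pad-All⁻ n ps)

stair-⟶[] : ∀ xs m → (stair xs , []) ⟶[ m ] (stair (pad xs m) , [])
stair-⟶[] xs zero    = done
stair-⟶[] xs (suc m) = step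
  (subst (λ as → (stair xs , []) ⟶ (as , [])) (sym (stair-lift xs)) (translate false (stair xs) []))
  (stair-⟶[] (xs ++ [ 0 ]) m)

charge-stair : ∀ xs → charge (stair xs , []) ≡ + length xs
charge-stair xs = trans (ℤ.+-identityʳ _) (cong +_ (length-stair xs))

energy-stair : ∀ xs → 2 * energy (stair xs , []) ≡ 2 * sum xs + length xs * suc (length xs)
energy-stair []       = refl
energy-stair (x ∷ xs) = trans (lemma x (length xs) (length (stair xs)) (sum (stair xs)))
  (trans (cong (_+ (2 * x + 2 * suc (length xs))) (energy-stair xs)) (lemma′ x (length xs) (sum xs)))
  where
  lemma : ∀ x l m s → 2 * (suc m + (x + l + s) + 0) ≡ 2 * (m + s + 0) + (2 * x + 2 * suc l)
  lemma = ℕSolver.solve-∀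
  lemma′ : ∀ x l s → 2 * s + l * suc l + (2 * x + 2 * suc l) ≡ 2 * (x + s) + suc l * suc (suc l)
  lemma′ = ℕSolver.solve-∀

-- A staircase diagram of length l has energy l(l + 1)/2 above the size of its partition and charge
-- l, so the invariant retains exactly twice that size.
invariant-stair : ∀ xs → invariant (stair xs , []) ≡ + (2 * sum xs)
invariant-stair xs = begin
  + 2 ℤ.* + energy (stair xs , []) - ch ℤ.* (ch ℤ.+ + 1)
    ≡⟨ cong₂ (λ e c → e - c ℤ.* (c ℤ.+ + 1))
             (trans (sym (ℤ.pos-* 2 (energy (stair xs , [])))) (cong +_ (energy-stair xs)))
             (charge-stair xs) ⟩
  + (2 * sum xs + len * suc len) - + len ℤ.* (+ len ℤ.+ + 1)
    ≡⟨ cong (λ i → + (2 * sum xs) ℤ.+ i - + len ℤ.* (+ len ℤ.+ + 1)) (ℤ.pos-* len (suc len)) ⟩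
  + (2 * sum xs) ℤ.+ + len ℤ.* (+ 1 ℤ.+ + len) - + len ℤ.* (+ len ℤ.+ + 1)
    ≡⟨ lemma (+ (2 * sum xs)) (+ len) ⟩
  + (2 * sum xs) ∎
  where
  open ≡-Reasoning
  ch = charge (stair xs , [])
  len = length xs
  lemma : ∀ s l → s ℤ.+ l ℤ.* (+ 1 ℤ.+ l) - l ℤ.* (l ℤ.+ + 1) ≡ s
  lemma = ℤSolver.solve-∀

-- Jacobi's triple product: diagrams of fixed charge and partitions

triangle : ℕ → ℕ
triangle zero    = 0
triangle (suc n) = suc n + triangle n

-- Both i and -1-i index the triangular number i(i+1)/2.
stairIndex : ℤ → ℕ
stairIndex (+ i)    = i
stairIndex -[1+ i ] = i

2*triangle : ∀ n → 2 * triangle n ≡ n * suc n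
2*triangle zero    = refl
2*triangle (suc n) = trans (*-distribˡ-+ 2 (suc n) (triangle n))
  (trans (cong (λ t → 2 * suc n + t) (2*triangle n)) (lemma n))
  where
  lemma : ∀ n → 2 * suc n + n * suc n ≡ suc n * suc (suc n)
  lemma = ℕSolver.solve-∀

2*triangle-stairIndex : ∀ k → + (2 * triangle (stairIndex k)) ≡ k ℤ.* (k ℤ.+ + 1)
2*triangle-stairIndex (+ i) = trans (cong +_ (2*triangle i))
  (trans (ℤ.pos-* i (suc i)) (cong (λ j → + i ℤ.* + j) (+-comm 1 i)))
2*triangle-stairIndex -[1+ i ] = trans (cong +_ (2*triangle i))
  (trans (ℤ.pos-* i (suc i)) (lemma (+ i)))
  where
  lemma : ∀ i → i ℤ.* (+ 1 ℤ.+ i) ≡ ℤ.- (+ 1 ℤ.+ i) ℤ.* (ℤ.- (+ 1 ℤ.+ i) ℤ.+ + 1)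
  lemma = ℤSolver.solve-∀

MayaOf : ℤ → ℕ → Pred Maya 0ℓ
MayaOf k n x = IsMaya x × charge x ≡ k × energy x ≡ n

-- The partition ys is read off once enough translations have emptied the second row.
Profile : Maya → List ℕ → Set
Profile x ys = ∃₂ λ k m → x ⟶[ k ] (stair (pad ys m) , [])

-- Once the second row is empty, further translations only append zeros. Two runs of different
-- lengths can thus be prolonged to a common length.
Profile-extend : ∀ xs m → x ⟶[ k ] (stair (pad xs m) , []) → ∀ l →
                 x ⟶[ k + l ] (stair (pad xs (m + l)) , [])
Profile-extend xs m p l =
  p ▻▻ subst (λ zs → _ ⟶[ l ] (stair zs , [])) (pad-pad xs m l) (stair-⟶[] (pad xs m) l)

-- The charge of the final diagram is the number of its parts, zeros included; hence the initial
-- charge and the length of the run fix the amount of padding.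
Profile-charge : ∀ xs m → x ⟶[ k ] (stair (pad xs m) , []) → + (length xs + m) ≡ charge x ℤ.+ + k
Profile-charge xs m p =
  trans (trans (cong +_ (sym (length-pad xs m))) (sym (charge-stair (pad xs m)))) (⟶[]-charge p)

Profile-invariant : Profile x ys → invariant x ≡ + (2 * sum ys)
Profile-invariant {ys = ys} (k , m , p) = trans (sym (⟶[]-invariant p))
  (trans (invariant-stair (pad ys m)) (cong (λ s → + (2 * s)) (sum-pad ys m)))

-- Prolonging each run by the length of the other makes both of length `k + l`; determinism
-- identifies their ends, and stripping zeros identifies the partitions.
Profile-functional : Positive xs → Positive ys → Profile x xs → Profile x ys → xs ≡ ys
Profile-functional {xs} {ys} {x} xs+ ys+ (k , m , p) (l , n , q) =
  pad-injective {m = m + l} {n = n + k} xs+ ys+ (stair-injective _ _ (cong proj₁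
    (⟶[]-deterministic (Profile-extend xs m p l)
      (subst (x ⟶[_] (stair (pad ys (n + k)) , [])) (+-comm l k) (Profile-extend ys n q k)))))

-- After prolongation to a common length, equal charges force equal padding, so both runs end in the
-- same diagram and can be traced back.
Profile-injective : charge x ≡ charge y → Profile x xs → Profile y xs → x ≡ y
Profile-injective {x} {y} {xs} c≡ (k , m , p) (l , n , q) =
  ⟶[]-injective p′ (subst₂ (λ i j → y ⟶[ i ] (stair (pad xs j) , [])) (+-comm l k) n+k≡m+l q′)
  where
  p′ = Profile-extend xs m p l
  q′ = Profile-extend xs n q k
  n+k≡m+l : n + k ≡ m + l
  n+k≡m+l = +-cancelˡ-≡ (length xs) _ _ (ℤ.+-injective (begin
    + (length xs + (n + k))  ≡⟨ Profile-charge xs (n + k) q′ ⟩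
    charge y ℤ.+ + (l + k)   ≡⟨ cong₂ (λ c i → c ℤ.+ + i) (sym c≡) (+-comm l k) ⟩
    charge x ℤ.+ + (k + l)   ≡⟨ Profile-charge xs (m + l) p′ ⟨
    + (length xs + (m + l))  ∎))
    where open ≡-Reasoning

Profile-total : IsMaya x → ∃[ ys ] IsPartition ys × Profile x ys
Profile-total {as , bs} mx
  -- No entry exceeds the sum of the row, so `suc (sum bs)` translations suffice.
  with as′ , as′↘ , p ← drain (suc (sum bs)) mx (All.map s≤s (all≤sum bs))
  with zs , zs↘ , refl ← stair-surjective as′↘
  with ys , m , ys↘ , ys+ , refl ← unpad zs↘ =
  ys , (AllPairs⇒Linked ys↘ , ys+) , _ , m , p

-- A run of length `l` from charge `k` must end at charge `k + l`, realised by `n` parts and `m`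
-- zeros. For negative `k` the run is lengthened to compensate; otherwise zeros absorb the charge.
charged-length : ∀ k n → ∃₂ λ l m → + (n + m) ≡ k ℤ.+ + l
charged-length (+ i) n = n , i , cong +_ (+-comm n i)
charged-length -[1+ i ] n = suc i + n , 0 , lemma (+ 1 ℤ.+ + i) (+ n)
  where
  lemma : ∀ i n → n ℤ.+ + 0 ≡ ℤ.- i ℤ.+ (i ℤ.+ n)
  lemma = ℤSolver.solve-∀

-- The padded staircase is traced back `l` translations; the choice of `l` and `m` makes the initial
-- charge `k`.
Profile-surjective : ∀ k → IsPartition ys → ∃[ x ] IsMaya x × charge x ≡ k × Profile x ys
Profile-surjective {ys} k (ys↘ , _) with l , m , eq ← charged-length k (length ys)
  with x , mx , p ← ⟶[]-surjective l
         (stair-decreasing (pad-weaklyDecreasing m (Linked⇒AllPairs (flip ≤-trans) ys↘)) , []) =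
  x , mx , ℤ-Group.∙-cancelʳ (+ l) _ _ (trans (sym (Profile-charge ys m p)) eq) , l , m , p

-- The conserved quantity, evaluated at the end of the run, is solved for the initial energy.
energy-Profile : Profile x ys → + (2 * energy x) ≡ + (2 * (sum ys + triangle (stairIndex (charge x))))
energy-Profile {x} {ys} p = begin
  + (2 * energy x)                          ≡⟨ ℤ.pos-* 2 (energy x) ⟩
  + 2 ℤ.* + energy x                        ≡⟨ lemma (+ 2 ℤ.* + energy x) (charge x ℤ.* (charge x ℤ.+ + 1)) ⟩
  invariant x ℤ.+ charge x ℤ.* (charge x ℤ.+ + 1)
    ≡⟨ cong₂ ℤ._+_ (Profile-invariant p) (sym (2*triangle-stairIndex (charge x))) ⟩
  + (2 * sum ys + 2 * triangle (stairIndex (charge x)))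
    ≡⟨ cong +_ (*-distribˡ-+ 2 (sum ys) _) ⟨
  + (2 * (sum ys + triangle (stairIndex (charge x)))) ∎
  where
  open ≡-Reasoning
  lemma : ∀ i j → i ≡ i - j ℤ.+ j
  lemma = ℤSolver.solve-∀

maya≃partition : ∀ k n →
  MayaOf k n ≃ (λ ys → IsPartition ys × sum ys + triangle (stairIndex k) ≡ n)
maya≃partition k n = record
  { _∼_        = Profile
  ; total      = λ { {x} (mx , refl , refl) → let ys , ypar , p = Profile-total mx in
                     ys , (ypar , sym (energy≡ x ys p)) , p }
  ; surjective = λ { {ys} (ypar , refl) → let x , mx , c≡k , p = Profile-surjective k ypar in
                     x , (mx , c≡k , trans (energy≡ x ys p)
                           (cong (λ c → sum ys + triangle (stairIndex c)) c≡k)) , p }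
  ; functional = λ _ ((_ , ys+) , _) ((_ , zs+) , _) → Profile-functional ys+ zs+
  ; injective  = λ (_ , cx , _) (_ , cy , _) _ → Profile-injective (trans cx (sym cy))
  }
  where
  energy≡ : ∀ x ys → Profile x ys → energy x ≡ sum ys + triangle (stairIndex (charge x))
  energy≡ x ys p = *-cancelˡ-≡ _ _ 2 (ℤ.+-injective (energy-Profile p))

-- Staircase parts and the mex

insert : ℕ → List ℕ → List ℕ
insert v []       = v ∷ []
insert v (x ∷ xs) with x ≤? v
... | yes _ = v ∷ x ∷ xs
... | no  _ = x ∷ insert v xs

insert-All⁺ : ∀ {P : Pred ℕ 0ℓ} → P v → All P xs → All P (insert v xs)
insert-All⁺ pv [] = pv ∷ []
insert-All⁺ {v} {x ∷ _} pv (px ∷ pxs) with x ≤? v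
... | yes _ = pv ∷ px ∷ pxs
... | no  _ = px ∷ insert-All⁺ pv pxs

insert-weaklyDecreasing : WeaklyDecreasing xs → WeaklyDecreasing (insert v xs)
insert-weaklyDecreasing [] = [] ∷ []
insert-weaklyDecreasing {x ∷ _} {v} (x≥ ∷ xs↘) with x ≤? v
... | yes x≤v = (x≤v ∷ All.map (λ p → ≤-trans p x≤v) x≥) ∷ x≥ ∷ xs↘
... | no  x≰v = insert-All⁺ (<⇒≤ (≰⇒> x≰v)) x≥ ∷ insert-weaklyDecreasing xs↘

sum-insert : ∀ v xs → sum (insert v xs) ≡ v + sum xs
sum-insert v []       = refl
sum-insert v (x ∷ xs) with x ≤? v
... | yes _ = refl
... | no  _ = trans (cong (λ s → x + s) (sum-insert v xs)) (lemma x v (sum xs))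
  where
  lemma : ∀ x v s → x + (v + s) ≡ v + (x + s)
  lemma = ℕSolver.solve-∀

∈-insert : ∀ v xs → v ∈ insert v xs
∈-insert v []       = here refl
∈-insert v (x ∷ xs) with x ≤? v
... | yes _ = here refl
... | no  _ = there (∈-insert v xs)

insert-∈⁺ : m ∈ xs → m ∈ insert v xs
insert-∈⁺ {v = v} (here {x} refl) with x ≤? v
... | yes _ = there (here refl)
... | no  _ = here refl
insert-∈⁺ {v = v} (there {x} m∈) with x ≤? v
... | yes _ = there (there m∈)
... | no  _ = there (insert-∈⁺ m∈)

insert-∈⁻ : ∀ xs → m ∈ insert v xs → m ≡ v ⊎ m ∈ xs
insert-∈⁻ [] (here refl) = inj₁ refl
insert-∈⁻ {v = v} (x ∷ xs) m∈ with x ≤? v | m∈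
... | yes _ | here refl = inj₁ refl
... | yes _ | there m∈′ = inj₂ m∈′
... | no  _ | here refl = inj₂ (here refl)
... | no  _ | there m∈′ with insert-∈⁻ xs m∈′
...   | inj₁ m≡v = inj₁ m≡v
...   | inj₂ m∈″ = inj₂ (there m∈″)

-- If `v` were put in front of one list but not of the other, comparing heads would make an entry
-- that is not at most `v` equal to `v`.
insert-injective : ∀ v xs ys → insert v xs ≡ insert v ys → xs ≡ ys
insert-injective v [] [] eq = refl
insert-injective v [] (y ∷ ys) eq with y ≤? v | eq
... | yes _   | ()
... | no  y≰v | eq′ = contradiction (≤-reflexive (sym (∷-injectiveˡ eq′))) y≰v
insert-injective v (x ∷ xs) [] eq with x ≤? v | eq
... | yes _   | ()
... | no  x≰v | eq′ = contradiction (≤-reflexive (∷-injectiveˡ eq′)) x≰v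
insert-injective v (x ∷ xs) (y ∷ ys) eq with x ≤? v | y ≤? v
... | yes _   | yes _   = ∷-injectiveʳ eq
... | yes _   | no  y≰v = contradiction (≤-reflexive (sym (∷-injectiveˡ eq))) y≰v
... | no  x≰v | yes _   = contradiction (≤-reflexive (∷-injectiveˡ eq)) x≰v
... | no  _   | no  _   =
  cong₂ _∷_ (∷-injectiveˡ eq) (insert-injective v xs ys (∷-injectiveʳ eq))

insert-All⁻ : ∀ {P : Pred ℕ 0ℓ} xs → All P (insert v xs) → All P xs
insert-All⁻ [] _ = []
insert-All⁻ {v} (x ∷ xs) ps with x ≤? v | ps
... | yes _ | _ ∷ ps′ = ps′
... | no  _ | p ∷ ps′ = p ∷ insert-All⁻ xs ps′

insert-head : ∀ {x} → WeaklyDecreasing (x ∷ xs) → insert x xs ≡ x ∷ xs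
insert-head {[]} _ = refl
insert-head {y ∷ _} {x} ((x≥y ∷ _) ∷ _) with y ≤? x
... | yes _   = refl
... | no  y≰x = contradiction x≥y y≰x

insert-tail : ∀ {x} xs → v < x → insert v (x ∷ xs) ≡ x ∷ insert v xs
insert-tail {v} {x} xs v<x with x ≤? v
... | yes x≤v = contradiction x≤v (<⇒≱ v<x)
... | no  _   = refl

insert-surjective : WeaklyDecreasing xs → v ∈ xs → ∃[ ys ] WeaklyDecreasing ys × insert v ys ≡ xs
insert-surjective (x≥ ∷ xs↘) (here refl) = _ , xs↘ , insert-head (x≥ ∷ xs↘)
insert-surjective (x≥ ∷ xs↘) (there v∈) with m≤n⇒m<n∨m≡n (All.lookup x≥ v∈)
-- The given occurrence is deeper, but the head has the same value, and it is the head that gets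
-- removed.
... | inj₂ refl = _ , xs↘ , insert-head (x≥ ∷ xs↘)
... | inj₁ v<x with ys , ys↘ , refl ← insert-surjective xs↘ v∈ =
  _ ∷ ys , insert-All⁻ ys x≥ ∷ ys↘ , insert-tail ys v<x

Contains1‥ : ℕ → Pred (List ℕ) 0ℓ
Contains1‥ j xs = ∀ {i} → 1 ≤ i → i ≤ j → i ∈ xs

-- Here `s` is the weight not yet converted into parts, while the parts 1, ..., `j` are already
-- present.
StairPartition : ℕ → ℕ → ℕ → Pred (List ℕ) 0ℓ
StairPartition j s n xs = IsPartition xs × Contains1‥ j xs × sum xs + s ≡ n

-- Weight `suc j` is exchanged for a part `suc j`. Conversely, removing one copy of that part cannot
-- lose any of the smaller required parts.
insert-suc : ∀ j s n → StairPartition j (suc j + s) n ≃ StairPartition (suc j) s n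
insert-suc j s n = record
  { _∼_        = λ xs ys → insert (suc j) xs ≡ ys
  ; total      = λ { {xs} ((xs↘ , xs+) , cont , eq) → insert (suc j) xs ,
                     ((AllPairs⇒Linked (insert-weaklyDecreasing (Linked⇒AllPairs (flip ≤-trans) xs↘))
                      , insert-All⁺ (s≤s z≤n) xs+)
                     , contains-insert xs cont
                     , trans (sum≡ xs) eq) , refl }
  ; surjective = surj
  ; functional = λ { _ _ _ refl refl → refl }
  ; injective  = λ _ _ _ p q → insert-injective (suc j) _ _ (trans p (sym q))
  }
  where
  sum≡ : ∀ xs → sum (insert (suc j) xs) + s ≡ sum xs + (suc j + s)
  sum≡ xs = trans (cong (λ t → t + s) (sum-insert (suc j) xs)) (lemma j (sum xs) s)
    where
    lemma : ∀ j t s → suc j + t + s ≡ t + (suc j + s)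
    lemma = ℕSolver.solve-∀
  contains-insert : ∀ xs → Contains1‥ j xs → Contains1‥ (suc j) (insert (suc j) xs)
  contains-insert xs cont 1≤i i≤ with m≤n⇒m<n∨m≡n i≤
  ... | inj₁ i<   = insert-∈⁺ (cont 1≤i (s≤s⁻¹ i<))
  ... | inj₂ refl = ∈-insert (suc j) xs
  surj : ∀ {ys} → StairPartition (suc j) s n ys →
         ∃[ xs ] StairPartition j (suc j + s) n xs × insert (suc j) xs ≡ ys
  surj ((ys↘ , ys+) , cont , eq)
    with xs , xs↘ , refl ← insert-surjective (Linked⇒AllPairs (flip ≤-trans) ys↘) (cont (s≤s z≤n) ≤-refl) =
    xs , ((AllPairs⇒Linked xs↘ , insert-All⁻ xs ys+) , cont′ , trans (sym (sum≡ xs)) eq) , refl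
    where
    cont′ : Contains1‥ j xs
    cont′ 1≤i i≤j with insert-∈⁻ xs (cont 1≤i (m≤n⇒m≤1+n i≤j))
    ... | inj₁ refl = contradiction i≤j 1+n≰n
    ... | inj₂ i∈   = i∈

-- The triangular weight is spent on the parts 1, ..., `j` in increasing order, one exchange at a
-- time.
insert-stair : ∀ j s n → StairPartition 0 (triangle j + s) n ≃ StairPartition j s n
insert-stair zero    s n = ⇔⇒≃ id id
insert-stair (suc j) s n = ≃-trans
  (subst (λ t → StairPartition 0 t n ≃ StairPartition j (suc j + s) n)
    (lemma (triangle j) j s) (insert-stair j (suc j + s) n))
  (insert-suc j s n)
  where
  lemma : ∀ t j s → t + (suc j + s) ≡ suc j + t + s
  lemma = ℕSolver.solve-∀

1≤mex : ∀ xs → 1 ≤ mex xs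
1≤mex xs = proj₁ (proj₁ (proj₂ (hasMex xs)))

<mex⇒contains : ∀ {j} xs → j < mex xs → Contains1‥ j xs
<mex⇒contains xs j<mex {i} 1≤i i≤j with i ∈? xs
... | yes i∈ = i∈
... | no  i∉ = contradiction (≤-trans (proj₂ (proj₂ (hasMex xs)) (1≤i , i∉)) i≤j) (<⇒≱ j<mex)

contains⇒<mex : ∀ {j} xs → Contains1‥ j xs → j < mex xs
contains⇒<mex xs cont =
  ≰⇒> λ mex≤j → proj₂ (proj₁ (proj₂ (hasMex xs))) (cont (1≤mex xs) mex≤j)

MexPartition : ℤ → ℕ → Pred (List ℕ) 0ℓ
MexPartition k n xs = IsPartition xs × stairIndex k < mex xs × sum xs ≡ n

maya≃mexPartition : ∀ k n → MayaOf k n ≃ MexPartition k n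
maya≃mexPartition k n = ≃-trans (maya≃partition k n) (≃-trans
  -- With no reserved parts the containment condition is vacuous.
  (⇔⇒≃ (λ { {xs} (p , eq) → p , (λ { (s≤s _) () }) , trans (cong (λ t → sum xs + t) (+-identityʳ _)) eq })
       (λ { {xs} (p , _ , eq) → p , trans (cong (λ t → sum xs + t) (sym (+-identityʳ _))) eq }))
  (≃-trans (insert-stair (stairIndex k) 0 n)
  (⇔⇒≃ (λ { {xs} (p , cont , eq) → p , contains⇒<mex xs cont , trans (sym (+-identityʳ (sum xs))) eq })
       (λ { {xs} (p , j< , eq) → p , <mex⇒contains xs j< , trans (+-identityʳ (sum xs)) eq }))))

-- Colours

data Split : List ColoredInteger → List ℕ → List ℕ → Set where
  []   : Split [] [] []
  _∷⁰_ : ∀ m → Split r xs ys → Split ((m , 0F) ∷ r) (m ∷ xs) ys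
  _∷¹_ : ∀ m → Split r xs ys → Split ((m , 1F) ∷ r) xs (m ∷ ys)

≺-trans : Transitive _≺_
≺-trans {x} = ×-transitive isEquivalence (resp₂ _<_) <-trans
  (λ {i} {j} {k} → Fin.<-trans {i = i} {j} {k}) {x}

≺-asym : Asymmetric _≺_
≺-asym {x} = ×-asymmetric sym (resp₂ _<_) <-asym (λ {i} {j} → Fin.<-asym {x = i} {j}) {x}

_≻_ : ColoredInteger → ColoredInteger → Set
_≻_ = flip _≺_

Split-total : ∀ r → ∃₂ λ xs ys → Split r xs ys
Split-total []              = [] , [] , []
Split-total ((m , 0F) ∷ r) = let _ , _ , sp = Split-total r in _ , _ , m ∷⁰ sp
Split-total ((m , 1F) ∷ r) = let _ , _ , sp = Split-total r in _ , _ , m ∷¹ sp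

Split-functional : Split r xs ys → Split r xs′ ys′ → xs ≡ xs′ × ys ≡ ys′
Split-functional []        []         = refl , refl
Split-functional (m ∷⁰ sp) (.m ∷⁰ sp′) with refl , refl ← Split-functional sp sp′ = refl , refl
Split-functional (m ∷¹ sp) (.m ∷¹ sp′) with refl , refl ← Split-functional sp sp′ = refl , refl

Split-All⁺ : ∀ {P : Pred ColoredInteger 0ℓ} → Split r xs ys →
             All (λ x → P (x , 0F)) xs → All (λ y → P (y , 1F)) ys → All P r
Split-All⁺ []        _        _        = []
Split-All⁺ (m ∷⁰ sp) (p ∷ ps) qs       = p ∷ Split-All⁺ sp ps qs
Split-All⁺ (m ∷¹ sp) ps       (q ∷ qs) = q ∷ Split-All⁺ sp ps qs

Split-All⁻ : ∀ {P : Pred ColoredInteger 0ℓ} → Split r xs ys → All P r →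
             All (λ x → P (x , 0F)) xs × All (λ y → P (y , 1F)) ys
Split-All⁻ []        _        = [] , []
Split-All⁻ (m ∷⁰ sp) (p ∷ ps) = let qs , rs = Split-All⁻ sp ps in p ∷ qs , rs
Split-All⁻ (m ∷¹ sp) (p ∷ ps) = let qs , rs = Split-All⁻ sp ps in qs , p ∷ rs

≺⇒< : ∀ {m n c} → (m , c) ≺ (n , c) → m < n
≺⇒< (inj₁ m<n)       = m<n
≺⇒< (inj₂ (_ , c<c)) = contradiction c<c 1+n≰n

Split-decreasing : Split r xs ys → AllPairs _≻_ r → Decreasing xs × Decreasing ys
Split-decreasing []        []        = [] , []
Split-decreasing (m ∷⁰ sp) (p ∷ r↘) = let xs↘ , ys↘ = Split-decreasing sp r↘ in
  All.map ≺⇒< (proj₁ (Split-All⁻ sp p)) ∷ xs↘ , ys↘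
Split-decreasing (m ∷¹ sp) (p ∷ r↘) = let xs↘ , ys↘ = Split-decreasing sp r↘ in
  xs↘ , All.map ≺⇒< (proj₂ (Split-All⁻ sp p)) ∷ ys↘

-- If the first entries had different colours, the leading entries of the two colour classes would
-- each have to precede the other, against asymmetry.
Split-injective : AllPairs _≻_ r → AllPairs _≻_ r′ → Split r xs ys → Split r′ xs ys → r ≡ r′
Split-injective _        _         []        []          = refl
Split-injective (_ ∷ r↘) (_ ∷ r↘′) (m ∷⁰ sp) (.m ∷⁰ sp′) = cong (_ ∷_) (Split-injective r↘ r↘′ sp sp′)
Split-injective (_ ∷ r↘) (_ ∷ r↘′) (m ∷¹ sp) (.m ∷¹ sp′) = cong (_ ∷_) (Split-injective r↘ r↘′ sp sp′)
Split-injective (p ∷ _)  (q ∷ _)   (m ∷⁰ sp) (n ∷¹ sp′)  =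
  contradiction (All.head (proj₁ (Split-All⁻ sp′ q))) (≺-asym (All.head (proj₂ (Split-All⁻ sp p))))
Split-injective (p ∷ _)  (q ∷ _)   (m ∷¹ sp) (n ∷⁰ sp′)  =
  contradiction (All.head (proj₂ (Split-All⁻ sp′ q))) (≺-asym (All.head (proj₁ (Split-All⁻ sp p))))

Merged : List ℕ → List ℕ → Set
Merged xs ys = ∃[ r ] AllPairs _≻_ r × Split r xs ys

merge-∷⁰ : All (_< m) xs → All (_< m) ys → Merged xs ys → Merged (m ∷ xs) ys
merge-∷⁰ m>xs m>ys (r , r↘ , sp) =
  _ , Split-All⁺ sp (All.map inj₁ m>xs) (All.map inj₁ m>ys) ∷ r↘ , _ ∷⁰ sp

-- Equality with entries of `xs` is allowed since colour 1 exceeds colour 0: in a decreasing row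
-- `(m , 1F)` stands before `(m , 0F)`.
merge-∷¹ : All (_≤ m) xs → All (_< m) ys → Merged xs ys → Merged xs (m ∷ ys)
merge-∷¹ {m} m≥xs m>ys (r , r↘ , sp) =
  _ , Split-All⁺ sp (All.map below m≥xs) (All.map inj₁ m>ys) ∷ r↘ , _ ∷¹ sp
  where
  below : ∀ {x} → x ≤ m → (x , 0F) ≺ (m , 1F)
  below x≤m with m≤n⇒m<n∨m≡n x≤m
  ... | inj₁ x<m = inj₁ x<m
  ... | inj₂ x≡m = inj₂ (x≡m , s≤s z≤n)

merge : Decreasing xs → Decreasing ys → Merged xs ys
merge [] [] = [] , [] , []
merge (x> ∷ xs↘) [] = merge-∷⁰ x> [] (merge xs↘ [])
merge [] (y> ∷ ys↘) = merge-∷¹ [] y> (merge [] ys↘)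
merge {x ∷ _} {y ∷ _} xs↘@(x> ∷ xs↘′) ys↘@(y> ∷ ys↘′) = [
    (λ x≤y → merge-∷¹ (x≤y ∷ All.map (λ z<x → <⇒≤ (<-≤-trans z<x x≤y)) x>) y> (merge xs↘ ys↘′)) ,
    (λ y<x → merge-∷⁰ x> (y<x ∷ All.map (λ z<y → <-trans z<y y<x) y>) (merge xs↘′ ys↘))
  ]′ (≤-<-connex x y)

length-Split : Split r xs ys → length r ≡ length xs + length ys
length-Split []        = refl
length-Split (m ∷⁰ sp) = cong suc (length-Split sp)
length-Split {xs = xs} (m ∷¹ sp) = trans (cong suc (length-Split sp)) (sym (+-suc (length xs) _))

sum-Split : Split r xs ys → sum (map proj₁ r) ≡ sum xs + sum ys
sum-Split [] = refl
sum-Split {xs = _ ∷ xs} {ys} (m ∷⁰ sp) = trans (cong (λ t → m + t) (sum-Split sp)) (sym (+-assoc m (sum xs) (sum ys)))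
sum-Split {xs = xs} {_ ∷ ys} (m ∷¹ sp) = trans (cong (λ t → m + t) (sum-Split sp)) (lemma m (sum xs) (sum ys))
  where
  lemma : ∀ m s t → m + (s + t) ≡ s + (m + t)
  lemma = ℕSolver.solve-∀

-- Counting charged bipartitions

totalCharge : Fin 2 → ℤ
totalCharge a = + toℕ a - + 1

-- The pair of diagrams determines the first charge and both energies; carrying them as an index
-- lets `Σ-≃` transform the two diagrams independently.
MayaPairOf : Fin 2 → ℕ → Pred ((ℤ × ℕ × ℕ) × (Maya × Maya)) 0ℓ
MayaPairOf a n ((k , e , e′) , xy) =
  e + e′ ≡ n × (MayaOf k e ⟨×⟩ MayaOf (totalCharge a - k) e′) xy

SplitArray : Array → (ℤ × ℕ × ℕ) × (Maya × Maya) → Set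
SplitArray (as , bs) (_ , (as₀ , bs₀) , (as₁ , bs₁)) = Split as as₀ as₁ × Split bs bs₀ bs₁

-- Each colour contributes one diagram, with first row from the top of the array and second row from
-- the bottom. Lengths and sums add over colours, hence so do charge and energy.
arrays≃mayaPairs : ∀ a n → IsColoredFrobeniusOf a n ≃ MayaPairOf a n
arrays≃mayaPairs a n = record
  { _∼_        = SplitArray
  ; total      = tot
  ; surjective = surj
  ; functional = λ _ → func
  ; injective  = λ ((as↘ , bs↘ , _) , _) ((as↘′ , bs↘′ , _) , _) _ (s , t) (s′ , t′) →
                 cong₂ _,_ (Split-injective (pairs as↘) (pairs as↘′) s s′)
                           (Split-injective (pairs bs↘) (pairs bs↘′) t t′)
  }
  where
  pairs = Linked⇒AllPairs {R = _≻_} (flip ≺-trans)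

  weight-Split : ∀ {as bs as₀ bs₀ as₁ bs₁} → Split as as₀ as₁ → Split bs bs₀ bs₁ →
                 weight (as , bs) ≡ energy (as₀ , bs₀) + energy (as₁ , bs₁)
  weight-Split {as₀ = as₀} {bs₀} {as₁} {bs₁} s t =
    trans (cong₂ _+_ (cong₂ _+_ (length-Split s) (sum-Split s)) (sum-Split t))
      (lemma (length as₀) (length as₁) (sum as₀) (sum as₁) (sum bs₀) (sum bs₁))
    where
    lemma : ∀ l l′ i i′ j j′ → l + l′ + (i + i′) + (j + j′) ≡ l + i + j + (l′ + i′ + j′)
    lemma = ℕSolver.solve-∀

  charge-Split : ∀ {as bs as₀ bs₀ as₁ bs₁} → Split as as₀ as₁ → Split bs bs₀ bs₁ →
                 + length as - + length bs ≡ charge (as₀ , bs₀) ℤ.+ charge (as₁ , bs₁)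
  charge-Split {as₀ = as₀} {bs₀} {as₁} {bs₁} s t =
    trans (cong₂ (λ i j → + i - + j) (length-Split s) (length-Split t))
      (lemma (+ length as₀) (+ length as₁) (+ length bs₀) (+ length bs₁))
    where
    lemma : ∀ l l′ m m′ → l ℤ.+ l′ - (m ℤ.+ m′) ≡ l - m ℤ.+ (l′ - m′)
    lemma = ℤSolver.solve-∀

  tot : ∀ {Π} → IsColoredFrobeniusOf a n Π → ∃[ y ] MayaPairOf a n y × SplitArray Π y
  tot {as , bs} ((as↘ , bs↘ , balance) , refl)
    with as₀ , as₁ , s ← Split-total as | bs₀ , bs₁ , t ← Split-total bs
    with as₀↘ , as₁↘ ← Split-decreasing s (pairs as↘) | bs₀↘ , bs₁↘ ← Split-decreasing t (pairs bs↘) =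
    (_ , (as₀ , bs₀) , (as₁ , bs₁)) ,
    (sym (weight-Split s t) , ((as₀↘ , bs₀↘) , refl , refl) , ((as₁↘ , bs₁↘) , charge₁ , refl)) ,
    s , t
    where
    charge₁ : charge (as₁ , bs₁) ≡ totalCharge a - charge (as₀ , bs₀)
    charge₁ = trans (lemma (charge (as₀ , bs₀)) (charge (as₁ , bs₁)))
      (cong (λ i → i - charge (as₀ , bs₀)) (trans (sym (charge-Split s t)) balance))
      where
      lemma : ∀ i j → j ≡ i ℤ.+ j - i
      lemma = ℤSolver.solve-∀

  surj : ∀ {y} → MayaPairOf a n y → ∃[ Π ] IsColoredFrobeniusOf a n Π × SplitArray Π y
  surj {_ , (as₀ , bs₀) , (as₁ , bs₁)}
    (refl , ((as₀↘ , bs₀↘) , refl , refl) , ((as₁↘ , bs₁↘) , charge₁ , refl))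
    with as , as↘ , s ← merge as₀↘ as₁↘ | bs , bs↘ , t ← merge bs₀↘ bs₁↘ =
    (as , bs) , ((AllPairs⇒Linked as↘ , AllPairs⇒Linked bs↘ , balance) , weight-Split s t) , s , t
    where
    balance : + length as - + length bs ≡ totalCharge a
    balance = trans (charge-Split s t)
      (trans (cong (λ i → charge (as₀ , bs₀) ℤ.+ i) charge₁) (lemma (charge (as₀ , bs₀)) (totalCharge a)))
      where
      lemma : ∀ i j → i ℤ.+ (j - i) ≡ j
      lemma = ℤSolver.solve-∀

  func : ∀ {Π y y′} → MayaPairOf a n y → MayaPairOf a n y′ → SplitArray Π y → SplitArray Π y′ → y ≡ y′
  func (_ , (_ , refl , refl) , (_ , _ , refl)) (_ , (_ , refl , refl) , (_ , _ , refl)) (s , t) (s′ , t′)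
    with refl , refl ← Split-functional s s′ | refl , refl ← Split-functional t t′ = refl

-- The two energies are the sizes of the two partitions, so only the first charge need be
-- remembered.
mexPairs≃chargedBipartitions : ∀ d n →
  _≃_ {(ℤ × ℕ × ℕ) × (List ℕ × List ℕ)} {Bipartition × ℤ}
    (λ ((k , e , e′) , π) → e + e′ ≡ n × (MexPartition k e ⟨×⟩ MexPartition (d - k) e′) π)
    (λ ((π₁ , π₂) , k) → (π₁ , π₂) ⊢₂ n × stairIndex k < mex π₁ × stairIndex (d - k) < mex π₂)
mexPairs≃chargedBipartitions d n = record
  { _∼_        = λ ((k , _) , π) (ρ , l) → k ≡ l × π ≡ ρ
  ; total      = λ { {(k , _) , π} (refl , (p₁ , m₁ , refl) , (p₂ , m₂ , refl)) →
                     (π , k) , ((p₁ , p₂ , refl) , m₁ , m₂) , refl , refl }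
  ; surjective = λ { {(π₁ , π₂) , k} ((p₁ , p₂ , eq) , m₁ , m₂) →
                     ((k , sum π₁ , sum π₂) , π₁ , π₂) ,
                     (eq , (p₁ , m₁ , refl) , (p₂ , m₂ , refl)) , refl , refl }
  ; functional = λ { _ _ _ (refl , refl) (refl , refl) → refl }
  ; injective  = λ { (_ , (_ , _ , refl) , (_ , _ , refl)) (_ , (_ , _ , refl) , (_ , _ , refl)) _
                     (refl , refl) (refl , refl) → refl }
  }

-- For total charge -1 the charges k and -1 - k have the same `stairIndex`, so either sign of k
-- allows `mex₂` values. For total charge 0 the partner is -k, whose index is one smaller than that
-- of k > 0 and one larger than that of k < 0; hence `suc` and `pred`.
nonNegativeCharges negativeCharges : Fin 2 → Bipartition → ℕ
nonNegativeCharges 0F π         = mex₂ π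
nonNegativeCharges 1F (π₁ , π₂) = mex π₁ ⊓ suc (mex π₂)
negativeCharges 0F π         = mex₂ π
negativeCharges 1F (π₁ , π₂) = mex π₁ ⊓ pred (mex π₂)

charges : Fin 2 → Bipartition → List ℤ
charges a π = map +_ (upTo (nonNegativeCharges a π)) ++ map -[1+_] (upTo (negativeCharges a π))

charges-unique : ∀ a π → Unique (charges a π)
charges-unique a π = Unique.++⁺
  {xs = map +_ (upTo (nonNegativeCharges a π))}
  (Unique.map⁺ ℤ.+-injective (Unique.upTo⁺ (nonNegativeCharges a π)))
  (Unique.map⁺ ℤ.-[1+-injective (Unique.upTo⁺ (negativeCharges a π)))
  λ (k∈ , k∈′) → disjoint (∈-map⁻ +_ k∈) (∈-map⁻ -[1+_] k∈′)
  where
  disjoint : ∀ {k xs ys} → (∃[ i ] i ∈ xs × k ≡ + i) → (∃[ i ] i ∈ ys × k ≡ -[1+ i ]) → ⊥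
  disjoint (_ , _ , refl) (_ , _ , ())

length-charges : ∀ a π → length (charges a π) ≡ nonNegativeCharges a π + negativeCharges a π
length-charges a π = trans (length-++ (map +_ (upTo (nonNegativeCharges a π))))
  (cong₂ _+_ (length-map-upTo +_ (nonNegativeCharges a π)) (length-map-upTo -[1+_] (negativeCharges a π)))
  where
  length-map-upTo : ∀ (f : ℕ → ℤ) m → length (map f (upTo m)) ≡ m
  length-map-upTo f m = trans (length-map f (upTo m)) (length-upTo m)

∈-charges⁺ : ∀ a π k → stairIndex k < mex (proj₁ π) → stairIndex (totalCharge a - k) < mex (proj₂ π) →
             k ∈ charges a π
∈-charges⁺ a π (+ i) i<m₁ j<m₂ = ∈-++⁺ˡ (∈-map⁺ +_ (∈-upTo⁺ (bound a i i<m₁ j<m₂)))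
  where
  bound : ∀ a i → i < mex (proj₁ π) → stairIndex (totalCharge a - + i) < mex (proj₂ π) →
          i < nonNegativeCharges a π
  bound 0F zero    i<m₁ j<m₂ = ⊓-glb i<m₁ j<m₂
  bound 0F (suc i) i<m₁ j<m₂ = ⊓-glb i<m₁ j<m₂
  -- Charge 0 is always admissible, since both excludants are at least 1.
  bound 1F zero    i<m₁ j<m₂ = ⊓-glb i<m₁ (s≤s z≤n)
  bound 1F (suc i) i<m₁ j<m₂ = ⊓-glb i<m₁ (s≤s j<m₂)
∈-charges⁺ a π -[1+ i ] i<m₁ j<m₂ =
  ∈-++⁺ʳ (map +_ (upTo (nonNegativeCharges a π))) (∈-map⁺ -[1+_] (∈-upTo⁺ (bound a i<m₁ j<m₂)))
  where
  bound : ∀ a → i < mex (proj₁ π) → stairIndex (totalCharge a - -[1+ i ]) < mex (proj₂ π) →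
          i < negativeCharges a π
  bound 0F i<m₁ j<m₂ = ⊓-glb i<m₁ j<m₂
  bound 1F i<m₁ j<m₂ = ⊓-glb i<m₁ (pred-mono-≤ j<m₂)

∈-charges⁻ : ∀ a π {k} → k ∈ charges a π →
             stairIndex k < mex (proj₁ π) × stairIndex (totalCharge a - k) < mex (proj₂ π)
∈-charges⁻ a π k∈ with ∈-++⁻ (map +_ (upTo (nonNegativeCharges a π))) k∈
... | inj₁ k∈′ with i , i∈ , refl ← ∈-map⁻ +_ k∈′ = bound a i (∈-upTo⁻ i∈)
  where
  bound : ∀ a i → i < nonNegativeCharges a π →
          i < mex (proj₁ π) × stairIndex (totalCharge a - + i) < mex (proj₂ π)
  bound 0F zero    i< = m<n⊓o⇒m<n _ _ i< , m<n⊓o⇒m<o (mex (proj₁ π)) _ i<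
  bound 0F (suc i) i< = m<n⊓o⇒m<n _ _ i< , m<n⊓o⇒m<o (mex (proj₁ π)) _ i<
  bound 1F zero    i< = m<n⊓o⇒m<n _ _ i< , 1≤mex (proj₂ π)
  bound 1F (suc i) i< = m<n⊓o⇒m<n _ _ i< , s≤s⁻¹ (m<n⊓o⇒m<o (mex (proj₁ π)) _ i<)
... | inj₂ k∈′ with i , i∈ , refl ← ∈-map⁻ -[1+_] k∈′ = bound a (∈-upTo⁻ i∈)
  where
  bound : ∀ a → i < negativeCharges a π →
          i < mex (proj₁ π) × stairIndex (totalCharge a - -[1+ i ]) < mex (proj₂ π)
  bound 0F i< = m<n⊓o⇒m<n _ _ i< , m<n⊓o⇒m<o (mex (proj₁ π)) _ i<
  bound 1F i< = m<n⊓o⇒m<n _ _ i< , pred-cancel-< (m<n⊓o⇒m<o (mex (proj₁ π)) _ i<)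

arrays≃chargedBipartitions : ∀ a n →
  IsColoredFrobeniusOf a n ≃ (λ (π , k) → π ⊢₂ n × k ∈ charges a π)
arrays≃chargedBipartitions a n =
  ≃-trans (arrays≃mayaPairs a n)
  (≃-trans (Σ-≃ λ (k , e , e′) → ×-≃ (maya≃mexPartition k e) (maya≃mexPartition (totalCharge a - k) e′))
  (≃-trans (mexPairs≃chargedBipartitions (totalCharge a) n)
  (⇔⇒≃ (λ { {π , k} (p , m₁ , m₂) → p , ∈-charges⁺ a π k m₁ m₂ })
       (λ { {π , k} (p , k∈) → p , ∈-charges⁻ a π k∈ }))))

cψ₂-sum : ∀ a n →
  cψ₂ a n ≡ sum (map (λ π → nonNegativeCharges a π + negativeCharges a π) (list (bipartitions n)))
cψ₂-sum a n = begin
  cψ₂ a n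
    ≡⟨ ≃⇒length≡ (arrays≃chargedBipartitions a n) (coloredFrobeniusPartitions a n)
         (enumerateGraph (charges a) (charges-unique a) (bipartitions n)) ⟩
  length (graph (charges a) (list (bipartitions n)))
    ≡⟨ length-graph (charges a) (list (bipartitions n)) ⟩
  sum (map (length ∘ charges a) (list (bipartitions n)))
    ≡⟨ cong sum (map-cong (length-charges a) (list (bipartitions n))) ⟩
  sum (map (λ π → nonNegativeCharges a π + negativeCharges a π) (list (bipartitions n))) ∎
  where open ≡-Reasoning

-- Summing the numbers of admissible charges

sum-double : ∀ {A : Set} (f : A → ℕ) xs → sum (map (λ x → f x + f x) xs) ≡ 2 * sum (map f xs)
sum-double f []       = refl
sum-double f (x ∷ xs) = trans (cong (λ t → f x + f x + t) (sum-double f xs)) (lemma (f x) (sum (map f xs)))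
  where
  lemma : ∀ y t → y + y + 2 * t ≡ 2 * (y + t)
  lemma = ℕSolver.solve-∀

-- On the diagonal the minima are n and n - 1, one short of 2n: this deficit is what `E₂` counts.
⊓-suc-pred-≡ : ∀ m n → 1 ≤ n → m ≡ n → suc (m ⊓ suc n + m ⊓ pred n) ≡ 2 * (m ⊓ n)
⊓-suc-pred-≡ (suc n) (suc n) _ refl
  rewrite m≤n⇒m⊓n≡m (n≤1+n n) | m≥n⇒m⊓n≡n (n≤1+n n) | ⊓-idem n = lemma n
  where
  lemma : ∀ n → suc (suc n + n) ≡ 2 * suc n
  lemma = ℕSolver.solve-∀

-- Off the diagonal either both minima are m, or they are n + 1 and n - 1 and the shifts cancel.
⊓-suc-pred-≢ : ∀ m n → 1 ≤ n → m ≢ n → m ⊓ suc n + m ⊓ pred n ≡ 2 * (m ⊓ n)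
⊓-suc-pred-≢ m (suc n) _ m≢n with ≤-<-connex m n
... | inj₁ m≤n
  rewrite m≤n⇒m⊓n≡m m≤n | m≤n⇒m⊓n≡m (m≤n⇒m≤1+n m≤n) | m≤n⇒m⊓n≡m (m≤n⇒m≤1+n (m≤n⇒m≤1+n m≤n)) =
  cong (λ t → m + t) (sym (+-identityʳ m))
... | inj₂ n<m
  rewrite m≥n⇒m⊓n≡n n<m | m≥n⇒m⊓n≡n (<⇒≤ n<m) | m≥n⇒m⊓n≡n (≤∧≢⇒< n<m (m≢n ∘ sym)) = lemma n
  where
  lemma : ∀ n → suc (suc n) + n ≡ 2 * suc n
  lemma = ℕSolver.solve-∀

sum-⊓-suc-pred : ∀ {A : Set} (f g : A → ℕ) → (∀ x → 1 ≤ g x) → ∀ xs →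
  sum (map (λ x → f x ⊓ suc (g x) + f x ⊓ pred (g x)) xs) + length (filter (λ x → f x ≟ g x) xs)
  ≡ 2 * sum (map (λ x → f x ⊓ g x) xs)
sum-⊓-suc-pred f g 1≤g [] = refl
sum-⊓-suc-pred f g 1≤g (x ∷ xs) with f x ≟ g x
... | yes eq rewrite filter-accept (λ x → f x ≟ g x) {xs = xs} eq = trans
  (trans (lemma (f x ⊓ suc (g x) + f x ⊓ pred (g x)) _ _)
    (cong₂ _+_ (⊓-suc-pred-≡ (f x) (g x) (1≤g x) eq) (sum-⊓-suc-pred f g 1≤g xs)))
  (sym (*-distribˡ-+ 2 (f x ⊓ g x) _))
  where
  lemma : ∀ y s l → y + s + suc l ≡ suc y + (s + l)
  lemma = ℕSolver.solve-∀
... | no neq rewrite filter-reject (λ x → f x ≟ g x) {xs = xs} neq = trans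
  (trans (+-assoc (f x ⊓ suc (g x) + f x ⊓ pred (g x)) _ _)
    (cong₂ _+_ (⊓-suc-pred-≢ (f x) (g x) (1≤g x) neq) (sum-⊓-suc-pred f g 1≤g xs)))
  (sym (*-distribˡ-+ 2 (f x ⊓ g x) _))

corollary3p4 : (n : ℕ) →
    (cψ₂ 0F n ≡ 2 * σmex₂ n) × (+ cψ₂ 1F n ≡ + (2 * σmex₂ n) - + E₂ n)
corollary3p4 n = trans (cψ₂-sum 0F n) (sum-double mex₂ (list (bipartitions n))) ,
  -- The summation identity has `E₂ n` added on the left, within ℕ; adding and subtracting it in ℤ
  -- gives the stated difference.
  trans (lemma (+ cψ₂ 1F n) (+ E₂ n)) (cong (λ i → + i - + E₂ n)
    (trans (cong (λ i → i + E₂ n) (cψ₂-sum 1F n)) 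
      (sum-⊓-suc-pred (mex ∘ proj₁) (mex ∘ proj₂) (1≤mex ∘ proj₂) (list (bipartitions n)))))
  where
  lemma : ∀ i j → i ≡ i ℤ.+ j - j
  lemma = ℤSolver.solve-∀
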